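{- For any finite coloring of $\mathbb{N}$, there exist $a, b \in \mathbb{N}$ such that the set $\{a, b, ab, a(b+1)\}$ is monochromatic. That is, for every integer $r \geq 1$ and every partition $\mathbb{N} = A_1 \cup \cdots \cup A_r$ into pairwise disjoint sets, there exist $k \in \{1, \ldots, r\}$ and $a, b \in \mathbb{N}$ such that $\{a, b, ab, a(b+1)\} \subseteq A_k$.
   Context: Here $\mathbb{N} = \{1, 2, 3, \ldots\}$ denotes the set of positive integers. A finite coloring of $\mathbb{N}$ is a partition of $\mathbb{N}$ into finitely many pairwise disjoint sets (the color classes). A subset of $\mathbb{N}$ is monochromatic if it is entirely contained in one of the color classes. -}

module Defs where

open import Data.Fin.Base using (Fin)
open import Data.Nat.Base using (ℕ; NonZero)
open import Level using (Level; 0ℓ)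
open import Relation.Binary.PropositionalEquality using (_≢_)
open import Relation.Unary using (Pred; _≐_; _⊥_; ⋃)

-- The positive integers, as a subset of ℕ (which contains 0 here).
ℕ⁺ : Pred ℕ 0ℓ
ℕ⁺ n = NonZero n

-- Classes may be empty.
record IsFiniteColoring {ℓ : Level} (r : ℕ) (A : Fin r → Pred ℕ ℓ) : Set ℓ where
  field
    cover    : ℕ⁺ ≐ ⋃ (Fin r) A
    disjoint : ∀ {i j : Fin r} → i ≢ j → A i ⊥ A j

{-# OPTIONS --safe #-}
module Submission where

-- Call a colour i good if there is K such that for every N there are α and φ : [1..N] → [1..K] for
-- which α x φ(x) has colour i for all x ≤ N.  The set A of numbers of good colour is then
-- multiplicatively thickly syndetic: for each K there is N such that every α has a multiple α x,
-- x ≤ N, with α x f ∈ A for all f ≤ K.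
--
-- A thickly syndetic set A admits arbitrarily long sequences u₀ < u₁ < … with
-- (u_k − u_j) / (u_j − u_i) ∈ A for all i < j < k.  Apply Ramsey's theorem to such a sequence, the
-- pair {j, k} being coloured by the tuple of the values φ(u_k − u_j) over all good colours.  With
-- s = u_j − u_i and b = (u_k − u_j) / s this makes φ constant on {s, sb, s(b+1)} for every good
-- colour at once, in particular for the colour i of b ∈ A, and a = α s φ(s) then puts a, ab and
-- a(b+1) into the colour of b.

open import Defs
open import Data.Bool.Base using (Bool; true; false; T)
open import Data.Empty using (⊥-elim)
open import Data.Fin.Base as Fin using (Fin; zero; suc; toℕ; fromℕ<; inject≤; funToFin; finToFun)
import Data.Fin.Properties as Fin
open import Data.List.Base using (List; []; _∷_; length; filter; allFin)
open import Data.List.Membership.Propositional using (_∈_; find)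
open import Data.List.Membership.Propositional.Properties using (∈-filter⁺; ∈-allFin)
open import Data.List.Properties using (filter-notAll; length-tabulate)
open import Data.List.Relation.Unary.All as All using (All; []; _∷_)
import Data.List.Relation.Unary.All.Properties as All
open import Data.List.Relation.Unary.AllPairs as AllPairs using (AllPairs; []; _∷_)
import Data.List.Relation.Unary.AllPairs.Properties as AllPairs
open import Data.List.Relation.Unary.Any as Any using (here; there)
open import Data.Nat.Base
open import Data.Nat.Divisibility using (_∣_; divides; ∣-trans; m∣m*n; m≤n⇒m!∣n!)
open import Data.Nat.Properties
open import Data.Nat.Tactic.RingSolver using (solve-∀)
open import Data.Product.Base using (∃; ∃-syntax; Σ-syntax; _×_; _,_; proj₁; proj₂)
open import Data.Sum.Base using (_⊎_; inj₁; inj₂)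
open import Data.Unit.Base using (tt)
open import Function.Base using (_∘_; id)
open import Level using (Level; 0ℓ)
open import Relation.Binary.Core using (Rel)
import Relation.Binary.Definitions as Binary
open import Relation.Binary.PropositionalEquality
open import Relation.Nullary.Decidable using (Dec; does; yes; no; ¬?)
open import Relation.Nullary.Negation using (¬_; contradiction)
open import Relation.Unary using (Pred; Decidable; _⊆_)

-- Ramsey's theorem for triangles in a list.

length-filter+length-filter-∁ : {X : Set} {P : Pred X 0ℓ} (P? : Decidable P) (xs : List X) →
  length (filter P? xs) + length (filter (¬? ∘ P?) xs) ≡ length xs
length-filter+length-filter-∁ P? [] = refl
length-filter+length-filter-∁ P? (x ∷ xs) with does (P? x)
... | true  = cong suc (length-filter+length-filter-∁ P? xs)
... | false = trans (+-suc _ _) (cong suc (length-filter+length-filter-∁ P? xs))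

module _ {X : Set} {R : Rel X 0ℓ} where

  findPair : {P : Rel X 0ℓ} → Binary.Decidable P → ∀ {xs} → AllPairs R xs →
    (∃[ x ] ∃[ y ] (x ∈ xs × y ∈ xs × R x y × P x y)) ⊎ AllPairs (λ x y → ¬ P x y) xs
  findPair P? [] = inj₂ []
  findPair P? {x ∷ xs} (Rx ∷ Rxs) with Any.any? (P? x) xs | findPair P? Rxs
  ... | yes p | _ = let y , y∈ , Pxy = find p in
                    inj₁ (x , y , here refl , there y∈ , All.lookup Rx y∈ , Pxy)
  ... | no ¬p | inj₁ (y , z , y∈ , z∈ , q) = inj₁ (y , z , there y∈ , there z∈ , q)
  ... | no ¬p | inj₂ ¬ps = inj₂ (All.¬Any⇒All¬ xs ¬p ∷ ¬ps)

module _ {X : Set} {m : ℕ} where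

  -- Pigeonhole by discarding colours: a class with fewer than `n` members can be filtered out,
  -- costing at most `n` points and one colour. `R` and `Q` survive because sublists inherit them.
  crowdedClass : {R : Rel X 0ℓ} (f : X → Fin m) (cs : List (Fin m)) (n : ℕ) {xs : List X} →
    AllPairs R xs → {Q : Pred X 0ℓ} → All Q xs → All (λ x → f x ∈ cs) xs → length cs * n < length xs →
    ∃[ c ] ∃[ ys ] (c ∈ cs × AllPairs R ys × All Q ys × All (λ y → f y ≡ c) ys × n ≤ length ys)
  crowdedClass f [] n {x ∷ xs} _ _ (() ∷ _) _
  crowdedClass f (c ∷ cs) n {xs} R Q f∈ lt
    with n ≤? length (filter (λ x → f x Fin.≟ c) xs)
  ... | yes n≤ = c , _ , here refl , AllPairs.filter⁺ _ R , All.filter⁺ _ Q , All.all-filter _ xs , n≤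
  ... | no n≰ =
    let d , ys , d∈ , rest = crowdedClass f cs n (AllPairs.filter⁺ _ R) (All.filter⁺ _ Q)
          (All.zipWith remove (All.filter⁺ (¬? ∘ c?) f∈ , All.all-filter (¬? ∘ c?) xs))
          (+-cancelˡ-< n _ _ (<-≤-trans lt (begin
            length xs ≡⟨ length-filter+length-filter-∁ c? xs ⟨
            length (filter c? xs) + length (filter (¬? ∘ c?) xs) ≤⟨ +-monoˡ-≤ _ (<⇒≤ (≰⇒> n≰)) ⟩
            n + length (filter (¬? ∘ c?) xs) ∎)))
    in d , ys , there d∈ , rest
    where
    open ≤-Reasoning
    c? : Decidable (λ x → f x ≡ c)
    c? x = f x Fin.≟ c
    remove : ∀ {x} → (f x ∈ c ∷ cs) × ¬ (f x ≡ c) → f x ∈ cs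
    remove (here eq , neq) = contradiction eq neq
    remove (there i , _)   = i

ramseyBound : ℕ → ℕ
ramseyBound zero    = 2
ramseyBound (suc k) = 2 + suc k * ramseyBound k

module _ {X : Set} {m : ℕ} {R : Rel X 0ℓ} (φ : X → X → Fin m) where

  MonoTriangle : Set
  MonoTriangle = ∃[ x ] ∃[ y ] ∃[ z ]
    (R x y × R y z × R x z × φ x y ≡ φ y z × φ x z ≡ φ y z)

  -- Some colour `c` joins `x` to at least `ramseyBound k` later points. Either two of these are
  -- joined by `c` too, closing a triangle, or `c` is absent among them and the number of colours
  -- drops.
  monoTriangle : ∀ k (cs : List (Fin m)) → length cs ≤ k → ∀ {xs} → AllPairs R xs →
    AllPairs (λ x y → φ x y ∈ cs) xs → ramseyBound k ≤ length xs → MonoTriangle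
  monoTriangle zero [] _ {_ ∷ []} _ _ (s≤s ())
  monoTriangle zero [] _ {_ ∷ _ ∷ _} _ ((() ∷ _) ∷ _) _
  monoTriangle (suc k) cs cs≤ {x ∷ xs} (Rx ∷ Rxs) (φx ∷ φxs) (s≤s len)
    with crowdedClass (φ x) cs (ramseyBound k)
           (AllPairs.zip (Rxs , φxs)) Rx φx
           (≤-trans (s≤s (*-monoˡ-≤ (ramseyBound k) cs≤)) len)
  ... | c , ys , c∈ , pairs , Rxy , φ≡c , n≤
    with AllPairs.unzip pairs
  ... | Rys , φys
    with findPair (λ y z → φ y z Fin.≟ c) Rys
  ... | inj₁ (y , z , y∈ , z∈ , Ryz , φyz) =
    x , y , z , All.lookup Rxy y∈ , Ryz , All.lookup Rxy z∈ ,
    trans (All.lookup φ≡c y∈) (sym φyz) , trans (All.lookup φ≡c z∈) (sym φyz)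
  ... | inj₂ ≢c =
    monoTriangle k (filter ≢c? cs)
      (≤-pred (≤-trans (filter-notAll ≢c? cs (Any.map (λ eq ne → ne (sym eq)) c∈)) cs≤))
      Rys (AllPairs.zipWith (λ (i , ne) → ∈-filter⁺ ≢c? i ne) (φys , ≢c)) n≤
    where
    ≢c? : Decidable (λ d → ¬ (d ≡ c))
    ≢c? d = ¬? (d Fin.≟ c)

-- Finite choice and bounds.

-- Stated as an implication so that the pick is total, with default `zero`; this yields functions on
-- all of ℕ.
choose : ∀ {n} {P : Pred (Fin (suc n)) 0ℓ} → Decidable P → ∃[ f ] (∃ P → P f)
choose P? with Fin.any? P?
... | yes (f , p) = f , λ _ → p
... | no ¬p       = zero , ⊥-elim ∘ ¬p

upperBound : ∀ {n} (k : Fin n → ℕ) → ∃[ B ] (∀ i → k i ≤ B)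
upperBound {zero}  k = 0 , λ ()
upperBound {suc n} k =
  let B , k≤B = upperBound (k ∘ suc) in
  k zero ⊔ B , λ where
    zero    → m≤m⊔n _ _
    (suc i) → ≤-trans (k≤B i) (m≤n⊔m (k zero) B)

-- Classical reasoning by continuations.

-- The existence claims below hold only classically.  Since the goal G is itself an existence
-- claim, negation into G and the corresponding continuation monad supply the classical logic.
module _ (G : Set) where

  M : ∀ {a} → Set a → Set a
  M X = (X → G) → G

module _ {G : Set} where

  return : ∀ {a} {X : Set a} → X → M G X
  return x k = k x

  _>>=_ : ∀ {a b} {X : Set a} {Y : Set b} → M G X → (X → M G Y) → M G Y
  (m >>= f) k = m (λ x → f x k)

  -- The double-negation shift, available by induction because the index set is finite.
  sequence : ∀ {n} {X : Fin n → Set} → (∀ i → M G (X i)) → M G (∀ i → X i)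
  sequence {zero}  m k = k (λ ())
  sequence {suc n} m k = m zero λ x → sequence (m ∘ suc) λ xs → k λ where
    zero    → x
    (suc i) → xs i

-- Thickly syndetic sets and sequences with quotients in them.

module _ (G : Set) where

  ThicklySyndetic : Pred ℕ 0ℓ → Set
  ThicklySyndetic A = ∀ K → M G (∃[ N ] (∀ α → 0 < α → M G (∃[ x ]
    (0 < x × x ≤ N × (∀ f → 0 < f → f ≤ K → A (α * x * f))))))

-- With δ = y − x, the rational number (f / d) δ is an integer in A for all d , f ≤ C x.  The slack in
-- d and f is what survives the affine substitution that lengthens a sequence by one term.
QuotientsIn : Pred ℕ 0ℓ → ℕ → Rel ℕ 0ℓ
QuotientsIn A C x y = ∃[ δ ] (0 < δ × y ≡ x + δ ×
  (∀ d f → 0 < d → d ≤ C * x → 0 < f → f ≤ C * x → ∃[ a ] (A a × d * a ≡ f * δ)))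

module _ {G : Set} where

  -- The bound H does not depend on the numbers y k.
  commonMultiplier : ∀ n (A : Fin n → Pred ℕ 0ℓ) → (∀ k → ThicklySyndetic G (A k)) →
    ∀ K → M G (∃[ H ] (0 < H × (∀ (y : Fin n → ℕ) → (∀ k → 0 < y k) → M G (∃[ h ]
      (0 < h × h ≤ H × (∀ k f → 0 < f → f ≤ K → A k (y k * h * f)))))))
  commonMultiplier zero A ts K =
    return (1 , z<s , λ _ _ → return (1 , z<s , ≤-refl , λ ()))
  commonMultiplier (suc n) A ts K = do
    H , 0<H , common ← commonMultiplier n (A ∘ suc) (ts ∘ suc) K
    -- Asking for factors up to `H * K` leaves room for the multiplier `h ≤ H` found after `x`.
    N , syndetic ← ts zero (H * K)
    -- `suc N` keeps the bound positive.
    return (suc N * H , *-mono-< (z<s {N}) 0<H , λ y 0<y → do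
      x , 0<x , x≤N , Ax ← syndetic (y zero) (0<y zero)
      h , 0<h , h≤H , Ah ← common (λ k → y (suc k) * x) (λ k → *-mono-< (0<y (suc k)) 0<x)
      return (x * h , *-mono-< 0<x 0<h , *-mono-≤ (m≤n⇒m≤1+n x≤N) h≤H , λ where
        zero f 0<f f≤K → subst (A zero) (assoc₁ (y zero) x h f)
          (Ax (h * f) (*-mono-< 0<h 0<f) (*-mono-≤ h≤H f≤K))
        (suc k) f 0<f f≤K → subst (A (suc k)) (assoc₂ (y (suc k)) x h f) (Ah k f 0<f f≤K)))
    where
    assoc₁ : ∀ y x h f → y * x * (h * f) ≡ y * (x * h) * f
    assoc₁ = solve-∀
    assoc₂ : ∀ y x h f → y * x * h * f ≡ y * (x * h) * f
    assoc₂ = solve-∀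

  quotientChain : ∀ A → ThicklySyndetic G A → ∀ n C → 0 < C → M G (Σ[ w ∈ (Fin n → ℕ) ]
    ((∀ k → 0 < w k) × (∀ {j k} → j Fin.< k → QuotientsIn A C (w j) (w k))))
  quotientChain A ts zero C 0<C = return ((λ ()) , (λ ()) , λ {j} → contradiction j Fin.¬Fin0)
  quotientChain A ts (suc n) C 0<C = do
    -- A sequence w for a larger constant becomes 1, 1 + g h w₀, 1 + g h w₁, …; since H is fixed
    -- before w, that constant can allow for every h ≤ H, and h is then chosen after w.
    H , 0<H , common ← commonMultiplier n (λ _ → A) (λ _ → ts) (g * C)
    w , 0<w , Qw ← quotientChain A ts n (C * (1 + g * H) * (g * H))
      (*-mono-< (*-mono-< 0<C (z<s {g * H})) (*-mono-< 0<g 0<H))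
    h , 0<h , h≤H , Ah ← common w 0<w
    return (prepend w h , prepend-positive w h ,
      λ {j} {k} → prepend-quotients h≤H 0<h 0<w Ah Qw {j} {k})
    where
    g : ℕ
    g = C !
    0<g : 0 < g
    0<g = 1≤n! C
    d∣g : ∀ {d} → 0 < d → d ≤ C → d ∣ g
    d∣g {suc d} _ d≤C = ∣-trans (m∣m*n (d !)) (m≤n⇒m!∣n! d≤C)

    -- Writing `g` as `q * d` turns `(f / d) * g * w * h` into `w * h * (q * f)`, and
    -- `q * f ≤ g * C` is a factor that the common multiplier covers.
    first : ∀ w h → (∀ f → 0 < f → f ≤ g * C → A (w * h * f)) → ∀ d f → 0 < d → d ≤ C →
      0 < f → f ≤ C → ∃[ a ] (A a × d * a ≡ f * (g * (w * h)))
    first w h Ah d f 0<d d≤C 0<f f≤C with d∣g 0<d d≤C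
    ... | divides zero eq = contradiction (subst (0 <_) eq 0<g) λ ()
    ... | divides q@(suc _) eq = w * h * (q * f) ,
      Ah (q * f) (*-mono-< (z<s {pred q}) 0<f) (*-mono-≤ q≤g f≤C) ,
      trans (rearrange d w h q f) (cong (λ g → f * (g * (w * h))) (sym eq))
      where
      rearrange : ∀ d w h q f → d * (w * h * (q * f)) ≡ f * (q * d * (w * h))
      rearrange = solve-∀
      q≤g : q ≤ g
      q≤g = subst (q ≤_) (sym eq) (m≤m*n q d {{>-nonZero 0<d}})

    -- The substitution scales differences by `g * h`, which is absorbed into the numerator `f`. The
    -- larger constant admits this numerator because `1 ≤ x` and `h ≤ H`.
    later : ∀ {H h x y} → h ≤ H → 0 < h → 0 < x → QuotientsIn A (C * (1 + g * H) * (g * H)) x y →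
      QuotientsIn A C (1 + g * (x * h)) (1 + g * (y * h))
    later {H} {h} {x} h≤H 0<h 0<x (δ , 0<δ , refl , quotient) =
      g * (δ * h) , *-mono-< 0<g (*-mono-< 0<δ 0<h) , expand g x δ h ,
      λ d f 0<d d≤ 0<f f≤ →
        let a , Aa , eq = quotient d (f * (g * h)) 0<d (≤-trans (m≤m*n d (g * h) {{gh≢0}}) (bound d≤))
                            (*-mono-< 0<f 0<gh) (bound f≤)
        in a , Aa , trans eq (regroup f g h δ)
      where
      0<gh : 0 < g * h
      0<gh = *-mono-< 0<g 0<h
      gh≢0 : NonZero (g * h)
      gh≢0 = >-nonZero 0<gh
      expand : ∀ g x δ h → 1 + g * ((x + δ) * h) ≡ 1 + g * (x * h) + g * (δ * h)
      expand = solve-∀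
      regroup : ∀ f g h δ → f * (g * h) * δ ≡ f * (g * (δ * h))
      regroup = solve-∀
      collect : ∀ C g H x → C * (x + g * (x * H)) * (g * H) ≡ C * (1 + g * H) * (g * H) * x
      collect = solve-∀
      bound : ∀ {e} → e ≤ C * (1 + g * (x * h)) → e * (g * h) ≤ C * (1 + g * H) * (g * H) * x
      bound {e} e≤ = begin
        e * (g * h)                         ≤⟨ *-mono-≤ e≤ (*-monoʳ-≤ g h≤H) ⟩
        C * (1 + g * (x * h)) * (g * H)     ≤⟨ *-monoˡ-≤ (g * H) (*-monoʳ-≤ C
                                                 (+-mono-≤ 0<x (*-monoʳ-≤ g (*-monoʳ-≤ x h≤H)))) ⟩
        C * (x + g * (x * H)) * (g * H)     ≡⟨ collect C g H x ⟩
        C * (1 + g * H) * (g * H) * x       ∎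
        where open ≤-Reasoning

    prepend : (Fin n → ℕ) → ℕ → Fin (suc n) → ℕ
    prepend w h zero    = 1
    prepend w h (suc k) = 1 + g * (w k * h)

    prepend-positive : ∀ w h k → 0 < prepend w h k
    prepend-positive w h zero    = z<s
    prepend-positive w h (suc k) = z<s

    prepend-quotients : ∀ {H h w} → h ≤ H → 0 < h → (∀ k → 0 < w k) →
      (∀ k f → 0 < f → f ≤ g * C → A (w k * h * f)) →
      (∀ {j k} → j Fin.< k → QuotientsIn A (C * (1 + g * H) * (g * H)) (w j) (w k)) →
      ∀ {j k} → j Fin.< k → QuotientsIn A C (prepend w h j) (prepend w h k)
    prepend-quotients {h = h} {w} _ 0<h 0<w Ah _ {zero} {suc k} _ =
      g * (w k * h) , *-mono-< 0<g (*-mono-< (0<w k) 0<h) , refl ,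
      λ d f 0<d d≤C 0<f f≤C → first (w k) h (Ah k) d f 0<d
        (subst (d ≤_) (*-identityʳ C) d≤C) 0<f (subst (f ≤_) (*-identityʳ C) f≤C)
    prepend-quotients h≤H 0<h 0<w _ Qw {suc j} {suc k} (s<s j<k) = later h≤H 0<h (0<w j) (Qw j<k)

  -- `N` comes before `φ` because the palettes that define `φ` are themselves chosen for a given
  -- `N`.
  schurTriple : ∀ A → ThicklySyndetic G A → ∀ m → M G (∃[ N ] (∀ (φ : ℕ → Fin m) →
    ∃[ s ] ∃[ b ] (0 < s × 0 < b × A b × s * (b + 1) ≤ N ×
      φ s ≡ φ (s * b) × φ (s * (b + 1)) ≡ φ (s * b))))
  schurTriple A ts m = do
    w , _ , Qw ← quotientChain A ts (ramseyBound (length (allFin m))) 1 z<s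
    let N , w≤N = upperBound w
    return (N , λ φ → fromTriangle φ (monoTriangle (λ x y → φ (y ∸ x)) _ (allFin m) ≤-refl
      (AllPairs.tabulate⁺-< {f = w} (λ j<k → Qw j<k , w≤N _))
      (AllPairs.tabulate⁺-< {f = w} (λ _ → ∈-allFin _))
      (≤-reflexive (sym (length-tabulate w)))))
    where
    fromTriangle : ∀ {N} (φ : ℕ → Fin m) →
      MonoTriangle {R = λ x y → QuotientsIn A 1 x y × y ≤ N} (λ x y → φ (y ∸ x)) →
      ∃[ s ] ∃[ b ] (0 < s × 0 < b × A b × s * (b + 1) ≤ N ×
        φ s ≡ φ (s * b) × φ (s * (b + 1)) ≡ φ (s * b))
    fromTriangle {N} φ (x , _ , _ , ((s , 0<s , refl , _) , _) , ((t , 0<t , refl , quotient) , z≤N) ,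
        _ , eq₁ , eq₂)
      -- The middle term is `x + s`, so the denominator `s` is within the bound even for constant 1;
      -- the quotient `t / s` is `b`.
      with quotient s 1 0<s (≤-trans (m≤n+m s x) (m≤n*m (x + s) 1))
             z<s (≤-trans 0<s (≤-trans (m≤n+m s x) (m≤n*m (x + s) 1)))
    ... | zero , _ , eq = contradiction (subst (0 <_) t≡0 0<t) λ ()
      where
      t≡0 : t ≡ 0
      t≡0 = trans (sym (*-identityˡ t)) (trans (sym eq) (*-zeroʳ s))
    ... | b@(suc _) , Ab , eq =
      s , b , 0<s , z<s , Ab ,
      subst (_≤ N) s+t≡ (≤-trans (m≤n+m (s + t) x) (≤-trans (≤-reflexive (sym (+-assoc x s t))) z≤N)) ,
      trans (cong φ (sym (m+n∸m≡n x s))) (trans eq₁ (cong φ t-diff)) ,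
      trans (cong φ (sym s+t-diff)) (trans eq₂ (cong φ t-diff))
      where
      t≡ : t ≡ s * b
      t≡ = trans (sym (*-identityˡ t)) (sym eq)
      s+t≡ : s + t ≡ s * (b + 1)
      s+t≡ = trans (cong (s +_) t≡) (rearrange s b)
        where
        rearrange : ∀ s b → s + s * b ≡ s * (b + 1)
        rearrange = solve-∀
      t-diff : x + s + t ∸ (x + s) ≡ s * b
      t-diff = trans (m+n∸m≡n (x + s) t) t≡
      s+t-diff : x + s + t ∸ x ≡ s * (b + 1)
      s+t-diff = trans (cong (_∸ x) (+-assoc x s t)) (trans (m+n∸m≡n x (s + t)) s+t≡)

-- Good and bad colours.

module _ {r : ℕ} (c : ℕ → Fin r) where

  Solution : Set
  Solution = ∃[ a ] ∃[ b ]
    (0 < a × 0 < b × c a ≡ c b × c (a * b) ≡ c b × c (a * (b + 1)) ≡ c b)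

  -- The guard `T good` makes this vacuous for bad colours, so all colours can be sequenced
  -- together. An element of `Fin (suc K)` stands for a factor in 1, ..., K + 1.
  Palette : ℕ → Bool → Fin r → Set
  Palette K good i = ∀ N → M Solution (∃[ α ] (0 < α × Σ[ φ ∈ (ℕ → Fin (suc K)) ]
    (∀ x → 0 < x → x ≤ N → T good → c (α * x * suc (toℕ (φ x))) ≡ i)))

  -- The last set is everything if `i` is good and the complement of class `i` if it is bad; over
  -- all `i` these sets intersect in the numbers of good colour.
  Classified : Fin r → Set
  Classified i = Σ[ good ∈ Bool ] (∃[ K ] Palette K good i) ×
    ThicklySyndetic Solution (λ n → c n ≡ i → T good)

  -- The first answer is "bad".  When its syndeticity is invoked for some K, the answer is revised to
  -- "good" with factors 1, …, K + 1; a failure of that palette is the syndeticity witness asked for.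
  classify : ∀ i → M Solution (Classified i)
  classify i k =
    k (false , (0 , λ N → return (1 , z<s , (λ _ → zero) , λ _ _ _ ())) , thick)
    where
    i? : ∀ K α x (f : Fin K) → Dec (c (α * x * suc (toℕ f)) ≡ i)
    i? K α x f = c (α * x * suc (toℕ f)) Fin.≟ i
    trivial : ThicklySyndetic Solution (λ n → c n ≡ i → T true)
    trivial K = return (1 , λ α _ → return (1 , z<s , ≤-refl , λ _ _ _ _ → tt))
    thick : ThicklySyndetic Solution (λ n → c n ≡ i → T false)
    thick K k′ = k (true , (K , palette) , trivial)
      where
      palette : Palette K true i
      palette N k″ = k′ (N , syndetic)
        where
        syndetic : ∀ α → 0 < α → M Solution (∃[ x ] (0 < x × x ≤ N ×
          (∀ f → 0 < f → f ≤ K → c (α * x * f) ≡ i → T false)))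
        -- A finite check: either every `x ≤ N` has a factor hitting `i`, giving the palette, or
        -- some `x` has none, giving the syndeticity witness.
        syndetic α 0<α k‴ with Fin.all? {n = N} (λ x → Fin.any? (i? (suc K) α (suc (toℕ x))))
        ... | yes hit = k″ (α , 0<α , φ , λ where
                (suc x) _ x<N _ → proj₂ (choose (i? (suc K) α (suc x)))
                  (subst (λ y → ∃[ f ] (c (α * suc y * suc (toℕ f)) ≡ i)) (Fin.toℕ-fromℕ< x<N)
                    (hit (fromℕ< x<N))))
          where
          φ : ℕ → Fin (suc K)
          φ x = proj₁ (choose (i? (suc K) α x))
        ... | no miss with Fin.¬∀⟶∃¬ N _ (λ x → Fin.any? (i? (suc K) α (suc (toℕ x)))) miss
        ...   | x , ¬hit = k‴ (suc (toℕ x) , z<s , Fin.toℕ<n x , λ where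
                (suc f) _ f<K eq → ¬hit (fromℕ< (m≤n⇒m≤1+n f<K) ,
                  trans (cong (λ g → c (α * suc (toℕ x) * suc g)) (Fin.toℕ-fromℕ< (m≤n⇒m≤1+n f<K))) eq))

  goodColours-thicklySyndetic : (good : Fin r → Bool) →
    (∀ i → ThicklySyndetic Solution (λ n → c n ≡ i → T (good i))) →
    ThicklySyndetic Solution (λ n → T (good (c n)))
  goodColours-thicklySyndetic good ts K = do
    H , _ , common ← commonMultiplier r (λ i n → c n ≡ i → T (good i)) ts K
    return (H , λ α 0<α → do
      h , 0<h , h≤H , Ah ← common (λ _ → α) (λ _ → 0<α)
      return (h , 0<h , h≤H , λ f 0<f f≤K → Ah _ f 0<f f≤K refl))

  solution : Solution
  -- The answer type is the goal itself, so the identity continuation extracts the witness.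
  solution = proof id
    where
    proof : M Solution Solution
    proof = do
      classified ← sequence classify
      let good : Fin r → Bool
          good i = proj₁ (classified i)
          size : Fin r → ℕ
          size i = proj₁ (proj₁ (proj₂ (classified i)))
          K , size≤K = upperBound size
      N , triple ← schurTriple (λ x → T (good (c x)))
        (goodColours-thicklySyndetic good (λ i → proj₂ (proj₂ (classified i)))) (suc K ^ r)
      palettes ← sequence (λ i → proj₂ (proj₁ (proj₂ (classified i))) N)
      let φ : ∀ i → ℕ → Fin (suc (size i))
          φ i = proj₁ (proj₂ (proj₂ (palettes i)))
          -- The values of all `φ i` are padded to a common range, so that `funToFin` packs the
          -- tuple into one of `suc K ^ r` colours.
          colour : ℕ → Fin r → Fin (suc K)
          colour x i = inject≤ (φ i x) (s≤s (size≤K i))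
          decode : ∀ {x y} → funToFin (colour x) ≡ funToFin (colour y) → ∀ i → φ i x ≡ φ i y
          decode {x} {y} eq i = Fin.inject≤-injective (s≤s (size≤K i)) (s≤s (size≤K i)) _ _
            (trans (sym (Fin.finToFun-funToFin (colour x) i))
              (trans (cong (λ e → finToFun e i) eq) (Fin.finToFun-funToFin (colour y) i)))
          s , b , 0<s , 0<b , good-b , le , eq₁ , eq₂ = triple (funToFin ∘ colour)
          i = c b
          α , 0<α , _ , hit = palettes i
          f = suc (toℕ (φ i s))
          s*b≤ : s * b ≤ N
          s*b≤ = ≤-trans (*-monoʳ-≤ s (m≤m+n b 1)) le
          s≤ : s ≤ N
          s≤ = ≤-trans (m≤m*n s (b + 1) {{>-nonZero (m≤n+m 1 b)}}) le
          hits : ∀ {x} → 0 < x → x ≤ N → φ i s ≡ φ i x → c (α * x * f) ≡ i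
          hits 0<x x≤N eq = subst (λ g → c (α * _ * suc (toℕ g)) ≡ i) (sym eq) (hit _ 0<x x≤N good-b)
      return (α * s * f , b , *-mono-< (*-mono-< 0<α 0<s) z<s , 0<b ,
        hits 0<s s≤ refl ,
        trans (cong c (rearrange α s f b)) (hits (*-mono-< 0<s 0<b) s*b≤ (decode eq₁ i)) ,
        trans (cong c (rearrange α s f (b + 1)))
          (hits (*-mono-< 0<s (m≤n+m 1 b)) le (decode (trans eq₁ (sym eq₂)) i)))
      where
      rearrange : ∀ α s f b → α * s * f * b ≡ α * (s * b) * f
      rearrange = solve-∀

-- From partitions to colouring functions.

theorem1 : ∀ {ℓ : Level} (r : ℕ) → r ≥ 1 → (A : Fin r → Pred ℕ ℓ) → IsFiniteColoring r A →
    ∃[ k ] ∃[ a ] ∃[ b ] (ℕ⁺ a × ℕ⁺ b ×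
    ((λ n → n ∈ a ∷ b ∷ a * b ∷ a * (b + 1) ∷ []) ⊆ A k))
theorem1 r _ A isColoring =
  let a , b , 0<a , 0<b , ca , cab , ca[b+1] = solution c in
  c b , a , b , >-nonZero 0<a , >-nonZero 0<b , λ where
    (here refl)                         → inClass 0<a ca
    (there (here refl))                 → inClass 0<b refl
    (there (there (here refl)))         → inClass (*-mono-< 0<a 0<b) cab
    (there (there (there (here refl)))) → inClass (*-mono-< 0<a (m≤n+m 1 b)) ca[b+1]
  where
  open IsFiniteColoring isColoring
  c : ℕ → Fin r
  -- 0 lies in no class and borrows the colour of 1.
  c zero    = proj₁ (proj₁ cover {1} _)
  c (suc n) = proj₁ (proj₁ cover {suc n} _)
  inClass : ∀ {n k} → 0 < n → c n ≡ k → A k n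
  inClass {suc n} _ refl = proj₂ (proj₁ cover {suc n} _)
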